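{- Let $n,d,k$ be positive integers with $n\ge dk$. Then the value of the single-treasure-per-door search game with parameters $(n,d,k)$ is $$v_1(n,d,k)=\frac{k^d}{\binom nd}.$$
   Context: The single-treasure-per-door search game with parameters $(n,d,k)$ is the following two-player zero-sum game. First the hider places $d$ treasures behind $n$ doors, at most one treasure behind each door. Then the searcher plays rounds: in each round she selects (guesses) a set of at most $k$ doors. If none of the selected doors hides a treasure not yet found, she loses immediately. Otherwise the hider reveals one not-yet-found treasure behind one of the selected doors (the hider chooses which one if there are several). The searcher wins if she finds all $d$ treasures with a total of $d$ guesses (rounds). The searcher's choices may be randomized and may depend on all previous answers; the hider may randomize his hiding and revealing choices. The value $v_1(n,d,k)$ is the probability that the searcher wins when both players play optimally. -}

module Defs where

open import Data.Bool.Base using (Bool; true; false; if_then_else_)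
open import Data.Fin.Base using (Fin)
open import Data.Fin.Subset using (Subset; _∈_; _∩_; _─_; ⁅_⁆; ⋃; ∣_∣; Nonempty)
open import Data.Fin.Subset.Properties using (nonempty?; _⊆?_)
open import Data.List.Base using (List; []; _∷_; map; foldr)
open import Data.List.Relation.Unary.All using (All)
open import Data.Nat.Base as ℕ using (ℕ; zero; suc; NonZero)
import Data.Nat.Properties as ℕ
open import Data.Nat.Combinatorics using (_C_; nCk+nC[k+1]≡[n+1]C[k+1])
open import Data.Product.Base using (∃-syntax; _×_; _,_; proj₁; proj₂)
open import Data.Rational.Base using (ℚ; 0ℚ; 1ℚ; _+_; _*_; _≤_)
import Data.Rational.Properties as ℚ
open import Relation.Binary.PropositionalEquality using (_≡_; subst)
open import Relation.Nullary.Decidable.Core using (does)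

sumℚ : List ℚ → ℚ
sumℚ = foldr _+_ 0ℚ

-- A finitely supported probability distribution with rational weights.
-- The same element may be listed several times; its weights then add up.
record Lottery (A : Set) : Set where
  field
    outcomes    : List (ℚ × A)
    nonNegative : All (λ o → 0ℚ ≤ proj₁ o) outcomes
    total       : sumℚ (map proj₁ outcomes) ≡ 1ℚ

open Lottery public

expectation : {A : Set} → Lottery A → (A → ℚ) → ℚ
expectation μ f = sumℚ (map (λ o → proj₁ o * f (proj₂ o)) (outcomes μ))

-- A two-player zero-sum game in normal form: Max receives the payoff from Min.
record ZeroSumGame : Set₁ where
  field
    Max Min : Set
    payoff  : Max → Min → ℚ

  expectedPayoff : Lottery Max → Lottery Min → ℚ
  expectedPayoff μ ν = expectation μ λ s → expectation ν λ t → payoff s t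

-- v is the value of G: Max has a mixed strategy securing at least v, and
-- Min has a mixed strategy conceding at most v.
IsValue : ZeroSumGame → ℚ → Set
IsValue G v =
    (∃[ μ ] ∀ ν → v ≤ expectedPayoff μ ν)
  × (∃[ ν ] ∀ μ → expectedPayoff μ ν ≤ v)
  where open ZeroSumGame G

IsValue-unique : ∀ {G v w} → IsValue G v → IsValue G w → v ≡ w
IsValue-unique ((μ , μ≥v) , (ν , ν≤v)) ((μ′ , μ′≥w) , (ν′ , ν′≤w)) =
  ℚ.≤-antisym (ℚ.≤-trans (μ≥v ν′) (ν′≤w μ)) (ℚ.≤-trans (μ′≥w ν) (ν≤v μ′))

-- The completed rounds, most recent first: the set of doors guessed and the
-- door at which the hider revealed a treasure.
History : ℕ → Set
History n = List (Subset n × Fin n)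

found : ∀ {n} → History n → Subset n
found h = ⋃ (map (λ r → ⁅ proj₂ r ⁆) h)

record SearcherStrategy (n k : ℕ) : Set where
  field
    guess   : History n → Subset n
    guess≤k : ∀ h → ∣ guess h ∣ ℕ.≤ k

-- The value of reveal is irrelevant when the guess contains no unfound
-- treasure, since the game then ends.
record HiderStrategy (n d : ℕ) : Set where
  field
    treasures   : Subset n
    ∣treasures∣ : ∣ treasures ∣ ≡ d
    reveal      : History n → Subset n → Fin n

  unfound : History n → Subset n
  unfound h = treasures ─ found h

  field
    reveal-legal : ∀ h q → Nonempty (q ∩ unfound h) → reveal h q ∈ q ∩ unfound h

module _ {n d k : ℕ} (σ : SearcherStrategy n k) (τ : HiderStrategy n d) where
  open SearcherStrategy σ
  open HiderStrategy τ

  -- Whether the searcher wins from history h with r guesses left.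
  searcherWinsFrom : (r : ℕ) (h : History n) → Bool
  searcherWinsFrom zero    h = does (treasures ⊆? found h)
  searcherWinsFrom (suc r) h =
    if does (nonempty? (guess h ∩ unfound h))
    then searcherWinsFrom r ((guess h , reveal h (guess h)) ∷ h)
    else false

  searcherWins : Bool
  searcherWins = searcherWinsFrom d []

-- The expected payoff is the probability that the searcher wins.
searchGame : (n d k : ℕ) → ZeroSumGame
searchGame n d k = record
  { Max    = SearcherStrategy n k
  ; Min    = HiderStrategy n d
  ; payoff = λ σ τ → if searcherWins σ τ then 1ℚ else 0ℚ
  }

C-nonZero : ∀ {n d} → d ℕ.≤ n → NonZero (n C d)
C-nonZero {n}     {zero}  _           = _
C-nonZero {suc n} {suc d} (ℕ.s≤s d≤n) =
  subst NonZero (nCk+nC[k+1]≡[n+1]C[k+1] n d)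
    (ℕ.>-nonZero (ℕ.≤-trans (ℕ.>-nonZero⁻¹ (n C d) {{C-nonZero d≤n}}) (ℕ.m≤m+n _ _)))

d*k≤n⇒nCd≢0 : ∀ {n} d k .{{_ : NonZero k}} → d ℕ.* k ℕ.≤ n → NonZero (n C d)
d*k≤n⇒nCd≢0 d k d*k≤n = C-nonZero (ℕ.≤-trans (ℕ.m≤m*n d k) d*k≤n)

{-# OPTIONS --safe #-}
module Submission where

-- Searcher: guess the members A₁, …, A_d of a uniformly random sequence of
-- disjoint k-sets in order, ignoring the answers.  If every Aᵢ contains exactly
-- one treasure, each answer is forced and she wins, so the reveal rule is
-- irrelevant; by symmetry this has probability k^d / C(n,d), there being k^d
-- transversals among the d-sets.
--
-- Hider: hide a uniformly random d-set and use any fixed reveal rule.  Against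
-- a deterministic searcher a won play is determined by its answers, at most k
-- possible ones per round, and its answers determine the treasures, so at most
-- k^d of the C(n,d) placements lose.

open import Defs
open import Algebra.Bundles using (CommutativeMonoid)
open import Data.Bool.Base using (Bool; true; false; if_then_else_; _∧_; T)
import Data.Bool.Properties as Bool
open import Data.Fin.Base using (Fin; zero; suc)
open import Data.Fin.Subset using (Subset; inside; outside; _∈_; _∉_; _⊆_; _∩_; _∪_; _─_; ⁅_⁆; ⊥; ⊤; ∣_∣; Nonempty)
open import Data.Fin.Subset.Properties
open import Data.Integer.Base using (+_)
import Data.Integer.Base as ℤ
import Data.Integer.Properties as ℤ
open import Data.List.Base using (List; []; _∷_; [_]; _++_; map; length; concatMap)
import Data.List.Membership.Propositional as List
import Data.List.Membership.Propositional.Properties as List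
import Data.List.Properties as List
open import Data.List.Relation.Unary.All as All using (All; []; _∷_)
import Data.List.Relation.Unary.All.Properties as All
open import Data.List.Relation.Unary.AllPairs using ([]; _∷_)
open import Data.List.Relation.Unary.Any as Any using (here; there)
open import Data.List.Relation.Unary.Unique.Propositional using (Unique)
import Data.List.Relation.Unary.Unique.Propositional.Properties as Unique
open import Data.Nat.Base using (ℕ; zero; suc; NonZero; _+_; _*_; _^_; _∸_; _!; _≤_; z≤n; s≤s; _≡ᵇ_)
open import Data.Nat.Combinatorics using (_C_; nCk+nC[k+1]≡[n+1]C[k+1]; nCk≡n!/k![n-k]!; k![n∸k]!∣n!)
open import Data.Nat.DivMod using (m/n*n≡m)
import Data.Nat.Properties as ℕ
open import Data.Nat.Solver using (module +-*-Solver)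
open import Data.Product.Base using (∃; _×_; _,_; proj₁; proj₂)
open import Data.Rational.Base using (ℚ; 0ℚ; 1ℚ; _/_)
import Data.Rational.Base as ℚ
import Data.Rational.Properties as ℚ
import Data.Rational.Unnormalised.Base as ℚᵘ
import Data.Rational.Unnormalised.Properties as ℚᵘ
open import Data.Sum.Base using (inj₁; inj₂)
open import Data.Vec.Base using (Vec; []; _∷_; here; there)
open import Data.Vec.Relation.Unary.All as Vec using ([]; _∷_)
open import Function.Base using (_∘_)
open import Relation.Binary.PropositionalEquality hiding ([_])
open import Relation.Nullary.Decidable using (yes; no; dec-true)
open import Relation.Nullary.Negation using (contradiction)

private
  variable
    A B : Set
    n : ℕ

-- Counting in lists

count : (A → Bool) → List A → ℕ
count p []       = 0
count p (x ∷ xs) = (if p x then 1 else 0) + count p xs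

count-++ : ∀ (p : A → Bool) xs ys → count p (xs ++ ys) ≡ count p xs + count p ys
count-++ p []       ys = refl
count-++ p (x ∷ xs) ys = trans (cong (λ m → _ + m) (count-++ p xs ys)) (sym (ℕ.+-assoc (if p x then 1 else 0) _ _))

count-map : ∀ (p : B → Bool) (f : A → B) xs → count p (map f xs) ≡ count (p ∘ f) xs
count-map p f []       = refl
count-map p f (x ∷ xs) = cong (λ m → _ + m) (count-map p f xs)

count-false : ∀ (xs : List A) → count (λ _ → false) xs ≡ 0
count-false []       = refl
count-false (x ∷ xs) = count-false xs

-- Pigeonhole: each counted `x` uses up one occurrence of `f x` in `ys`. Since the images are
-- distinct, no later element needs the deleted occurrence; `ys` itself may repeat entries.
count-≤-length : ∀ (p : A → Bool) (f : A → B) {xs} {ys : List B} → Unique (map f xs) →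
                 (∀ {x} → x List.∈ xs → p x ≡ true → f x List.∈ ys) → count p xs ≤ length ys
count-≤-length p f {[]}          _             _  = z≤n
count-≤-length p f {x ∷ xs} {ys} (fx∉ ∷ uniq) ∈ys with p x in px
... | false = count-≤-length p f uniq (∈ys ∘ there)
... | true with us , vs , refl ← List.∈-∃++ (∈ys (here refl) px) =
  subst (suc (count p xs) ≤_) (sym (List.length-++-sucʳ us (f x) vs))
    (s≤s (count-≤-length p f uniq λ y∈xs py →
      remove (All.lookup fx∉ (List.∈-map⁺ f y∈xs)) (∈ys (there y∈xs) py)))
  where
  remove : ∀ {z} → f x ≢ z → z List.∈ us ++ f x ∷ vs → z List.∈ us ++ vs
  remove fx≢z z∈ with List.∈-++⁻ us z∈
  ... | inj₁ z∈us         = List.∈-++⁺ˡ z∈us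
  ... | inj₂ (here z≡fx)  = contradiction (sym z≡fx) fx≢z
  ... | inj₂ (there z∈vs) = List.∈-++⁺ʳ us z∈vs

length-concatMap : ∀ {c} (f : A → List B) {xs} → All (λ x → length (f x) ≡ c) xs →
                   length (concatMap f xs) ≡ length xs * c
length-concatMap f                 []               = refl
length-concatMap f {xs = x ∷ xs} (∣fx∣≡c ∷ ∣fxs∣≡c) =
  trans (List.length-++ (f x)) (cong₂ _+_ ∣fx∣≡c (length-concatMap f ∣fxs∣≡c))

length-concatMap-≤ : ∀ {c} (f : A → List B) xs → (∀ x → length (f x) ≤ c) →
                     length (concatMap f xs) ≤ length xs * c
length-concatMap-≤ f []       ∣f∣≤c = z≤n
length-concatMap-≤ f (x ∷ xs) ∣f∣≤c =
  subst (_≤ _) (sym (List.length-++ (f x))) (ℕ.+-mono-≤ (∣f∣≤c x) (length-concatMap-≤ f xs ∣f∣≤c))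

-- The product rule for sequential choices: `q` tests the first choice, and `c` is the number of
-- good continuations of a choice that passes.
count-concatMap : ∀ {c} (p : B → Bool) (q : A → Bool) (f : A → List B) {xs} →
                  All (λ x → count p (f x) ≡ (if q x then c else 0)) xs →
                  count p (concatMap f xs) ≡ count q xs * c
count-concatMap p q f [] = refl
count-concatMap {c = c} p q f {xs = x ∷ xs} (eq ∷ eqs) = begin
  count p (f x ++ concatMap f xs)             ≡⟨ count-++ p (f x) (concatMap f xs) ⟩
  count p (f x) + count p (concatMap f xs)    ≡⟨ cong₂ _+_ (trans eq (if-* (q x))) (count-concatMap p q f eqs) ⟩
  (if q x then 1 else 0) * c + count q xs * c ≡⟨ ℕ.*-distribʳ-+ c (if q x then 1 else 0) (count q xs) ⟨
  count q (x ∷ xs) * c                        ∎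
  where
  open ≡-Reasoning
  if-* : ∀ b → (if b then c else 0) ≡ (if b then 1 else 0) * c
  if-* true  = sym (ℕ.*-identityˡ c)
  if-* false = refl

count-∧ : ∀ b (p : A → Bool) xs → count (λ x → b ∧ p x) xs ≡ (if b then count p xs else 0)
count-∧ true  p xs = refl
count-∧ false p xs = count-false xs

-- `All.reduce` turns certified sets or plans into strategies. Only an inequality results, since `p`
-- is merely assumed to imply `q`.
count-reduce : ∀ {P : A → Set} {xs} (p : A → Bool) (q : B → Bool) (f : ∀ {x} → P x → B) (pxs : All P xs) →
               (∀ {x} (px : P x) → p x ≡ true → q (f px) ≡ true) →
               count p xs ≤ count q (All.reduce f pxs)
count-reduce p q f []                  p⇒q = z≤n
count-reduce p q f (_∷_ {x = x} px pxs) p⇒q with p x in eq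
... | false = ℕ.≤-trans (count-reduce p q f pxs p⇒q) (ℕ.m≤n+m _ _)
... | true  rewrite p⇒q px eq = s≤s (count-reduce p q f pxs p⇒q)

length-reduce : ∀ {P : A → Set} {xs} (f : ∀ {x} → P x → B) (pxs : All P xs) →
                length (All.reduce f pxs) ≡ length xs
length-reduce f []         = refl
length-reduce f (px ∷ pxs) = cong suc (length-reduce f pxs)

map-reduce : ∀ {P : A → Set} {xs} (g : B → A) (f : ∀ {x} → P x → B) (pxs : All P xs) →
             (∀ {x} (px : P x) → g (f px) ≡ x) → map g (All.reduce f pxs) ≡ xs
map-reduce g f []         g∘f = refl
map-reduce g f (px ∷ pxs) g∘f = cong₂ _∷_ (g∘f px) (map-reduce g f pxs g∘f)

-- Expectations

indicator : Bool → ℚ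
indicator b = if b then 1ℚ else 0ℚ

toℚᵘ-/ : ∀ i n .{{_ : NonZero n}} → ℚ.toℚᵘ (i / n) ℚᵘ.≃ (i ℚᵘ./ n)
toℚᵘ-/ i (suc n) = ℚ.toℚᵘ-fromℚᵘ (ℚᵘ.mkℚᵘ i n)

-- Passes through unnormalised rationals, where the order is cross-multiplication by definition;
-- `_/_` on ℚ reduces to lowest terms.
/-mono-≤ : ∀ a b m n .{{_ : NonZero m}} .{{_ : NonZero n}} →
           a * n ≤ b * m → + a / m ℚ.≤ + b / n
/-mono-≤ a b m@(suc _) n@(suc _) an≤bm = ℚ.toℚᵘ-cancel-≤ (begin
  ℚ.toℚᵘ (+ a / m) ≃⟨ toℚᵘ-/ (+ a) m ⟩
  + a ℚᵘ./ m       ≤⟨ ℚᵘ.*≤* (subst₂ ℤ._≤_ (ℤ.pos-* a n) (ℤ.pos-* b m) (ℤ.+≤+ an≤bm)) ⟩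
  + b ℚᵘ./ n       ≃⟨ toℚᵘ-/ (+ b) n ⟨
  ℚ.toℚᵘ (+ b / n) ∎)
  where open ℚᵘ.≤-Reasoning

n/n≡1 : ∀ n .{{_ : NonZero n}} → + n / n ≡ 1ℚ
n/n≡1 n@(suc _) = ℚ.≤-antisym
  (/-mono-≤ n 1 n 1 (ℕ.≤-reflexive (ℕ.*-comm n 1)))
  (/-mono-≤ 1 n 1 n (ℕ.≤-reflexive (ℕ.*-comm 1 n)))

/-homo-+ : ∀ a b n .{{_ : NonZero n}} → + a / n ℚ.+ + b / n ≡ + (a + b) / n
/-homo-+ a b n@(suc _) = ℚ.toℚᵘ-injective (begin
  ℚ.toℚᵘ (+ a / n ℚ.+ + b / n)              ≈⟨ ℚ.toℚᵘ-homo-+ (+ a / n) (+ b / n) ⟩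
  ℚ.toℚᵘ (+ a / n) ℚᵘ.+ ℚ.toℚᵘ (+ b / n)    ≈⟨ ℚᵘ.+-cong (toℚᵘ-/ (+ a) n) (toℚᵘ-/ (+ b) n) ⟩
  (+ a ℚᵘ./ n) ℚᵘ.+ (+ b ℚᵘ./ n)            ≈⟨ ℚᵘ.*≡* same-denominator ⟩
  + (a + b) ℚᵘ./ n                          ≈⟨ toℚᵘ-/ (+ (a + b)) n ⟨
  ℚ.toℚᵘ (+ (a + b) / n)                    ∎)
  where
  open import Relation.Binary.Reasoning.Setoid ℚᵘ.≃-setoid
  same-denominator : (+ a ℤ.* + n ℤ.+ + b ℤ.* + n) ℤ.* + n ≡ + (a + b) ℤ.* (+ n ℤ.* + n)
  same-denominator = trans
    (cong (ℤ._* + n) (sym (ℤ.*-distribʳ-+ (+ n) (+ a) (+ b))))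
    (ℤ.*-assoc (+ (a + b)) (+ n) (+ n))

-- The sum inside `expectation`, on a bare list: the tail of a lottery is in general no lottery, so
-- inductions need this form.
weightedSum : List (ℚ × A) → (A → ℚ) → ℚ
weightedSum os f = sumℚ (map (λ o → proj₁ o ℚ.* f (proj₂ o)) os)

weightedSum-0 : ∀ (os : List (ℚ × A)) → weightedSum os (λ _ → 0ℚ) ≡ 0ℚ
weightedSum-0 []             = refl
weightedSum-0 ((w , _) ∷ os) = cong₂ ℚ._+_ (ℚ.*-zeroʳ w) (weightedSum-0 os)

weightedSum-+ : ∀ (os : List (ℚ × A)) f g →
                weightedSum os (λ x → f x ℚ.+ g x) ≡ weightedSum os f ℚ.+ weightedSum os g
weightedSum-+ []             f g = refl
weightedSum-+ ((w , x) ∷ os) f g = begin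
  w ℚ.* (f x ℚ.+ g x) ℚ.+ weightedSum os (λ y → f y ℚ.+ g y)
    ≡⟨ cong₂ ℚ._+_ (ℚ.*-distribˡ-+ w (f x) (g x)) (weightedSum-+ os f g) ⟩
  (w ℚ.* f x ℚ.+ w ℚ.* g x) ℚ.+ (weightedSum os f ℚ.+ weightedSum os g)
    ≡⟨ interchange (w ℚ.* f x) (w ℚ.* g x) (weightedSum os f) (weightedSum os g) ⟩
  (w ℚ.* f x ℚ.+ weightedSum os f) ℚ.+ (w ℚ.* g x ℚ.+ weightedSum os g) ∎
  where
  open ≡-Reasoning
  open import Algebra.Properties.CommutativeSemigroup
    (CommutativeMonoid.commutativeSemigroup ℚ.+-0-commutativeMonoid) using (interchange)

weightedSum-* : ∀ (os : List (ℚ × A)) c f →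
                weightedSum os (λ x → c ℚ.* f x) ≡ c ℚ.* weightedSum os f
weightedSum-* []             c f = sym (ℚ.*-zeroʳ c)
weightedSum-* ((w , x) ∷ os) c f = begin
  w ℚ.* (c ℚ.* f x) ℚ.+ weightedSum os (λ y → c ℚ.* f y)
    ≡⟨ cong₂ ℚ._+_ (x∙yz≈y∙xz w c (f x)) (weightedSum-* os c f) ⟩
  c ℚ.* (w ℚ.* f x) ℚ.+ c ℚ.* weightedSum os f
    ≡⟨ ℚ.*-distribˡ-+ c (w ℚ.* f x) (weightedSum os f) ⟨
  c ℚ.* (w ℚ.* f x ℚ.+ weightedSum os f) ∎
  where
  open ≡-Reasoning
  open import Algebra.Properties.CommutativeSemigroup
    (CommutativeMonoid.commutativeSemigroup ℚ.*-1-commutativeMonoid) using (x∙yz≈y∙xz)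

-- Fubini for finite sums. It lets the searcher's mixture be tested against one pure hider strategy
-- at a time, although `expectedPayoff` averages over the hider inside.
weightedSum-swap : ∀ (os : List (ℚ × A)) (qs : List (ℚ × B)) (g : A → B → ℚ) →
                   weightedSum os (λ x → weightedSum qs (g x)) ≡
                   weightedSum qs (λ y → weightedSum os (λ x → g x y))
weightedSum-swap []             qs g = sym (weightedSum-0 qs)
weightedSum-swap ((w , x) ∷ os) qs g = begin
  w ℚ.* weightedSum qs (g x) ℚ.+ weightedSum os (λ x′ → weightedSum qs (g x′))
    ≡⟨ cong₂ ℚ._+_ (sym (weightedSum-* qs w (g x))) (weightedSum-swap os qs g) ⟩
  weightedSum qs (λ y → w ℚ.* g x y) ℚ.+ weightedSum qs (λ y → weightedSum os (λ x′ → g x′ y))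
    ≡⟨ weightedSum-+ qs (λ y → w ℚ.* g x y) (λ y → weightedSum os (λ x′ → g x′ y)) ⟨
  weightedSum qs (λ y → weightedSum ((w , x) ∷ os) (λ x′ → g x′ y)) ∎
  where open ≡-Reasoning

weightedSum-const : ∀ (os : List (ℚ × A)) v → weightedSum os (λ _ → v) ≡ sumℚ (map proj₁ os) ℚ.* v
weightedSum-const []             v = sym (ℚ.*-zeroˡ v)
weightedSum-const ((w , _) ∷ os) v = trans
  (cong (w ℚ.* v ℚ.+_) (weightedSum-const os v))
  (sym (ℚ.*-distribʳ-+ v w (sumℚ (map proj₁ os))))

weightedSum-mono : ∀ {os : List (ℚ × A)} {f g} → All (λ o → 0ℚ ℚ.≤ proj₁ o) os →
                   (∀ x → f x ℚ.≤ g x) → weightedSum os f ℚ.≤ weightedSum os g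
weightedSum-mono []                          f≤g = ℚ.≤-refl
weightedSum-mono (_∷_ {x = w , x} 0≤w 0≤os) f≤g = ℚ.+-mono-≤
  (ℚ.*-monoˡ-≤-nonNeg w {{ℚ.nonNegative 0≤w}} (f≤g x))
  (weightedSum-mono 0≤os f≤g)

expectation-const : ∀ (μ : Lottery A) v → expectation μ (λ _ → v) ≡ v
expectation-const μ v = begin
  expectation μ (λ _ → v)             ≡⟨ weightedSum-const (outcomes μ) v ⟩
  sumℚ (map proj₁ (outcomes μ)) ℚ.* v ≡⟨ cong (ℚ._* v) (total μ) ⟩
  1ℚ ℚ.* v                            ≡⟨ ℚ.*-identityˡ v ⟩
  v                                   ∎
  where open ≡-Reasoning

expectation-≤ : ∀ (μ : Lottery A) {f v} → (∀ x → f x ℚ.≤ v) → expectation μ f ℚ.≤ v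
expectation-≤ μ f≤v = subst (_ ℚ.≤_) (expectation-const μ _) (weightedSum-mono (nonNegative μ) f≤v)

expectation-≥ : ∀ (μ : Lottery A) {f v} → (∀ x → v ℚ.≤ f x) → v ℚ.≤ expectation μ f
expectation-≥ μ v≤f = subst (ℚ._≤ _) (expectation-const μ _) (weightedSum-mono (nonNegative μ) v≤f)

-- The denominator `n` is not tied to the length of the list, so it stays fixed in inductions over
-- the list.
equalWeights : ∀ n .{{_ : NonZero n}} → List A → List (ℚ × A)
equalWeights n = map (+ 1 / n ,_)

weightedSum-indicator : ∀ n .{{_ : NonZero n}} (p : A → Bool) xs →
  weightedSum (equalWeights n xs) (λ x → indicator (p x)) ≡ + count p xs / n
weightedSum-indicator n p []       = sym (ℚ.0/n≡0 n)
weightedSum-indicator n p (x ∷ xs) = trans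
  (cong₂ ℚ._+_ (weight (p x)) (weightedSum-indicator n p xs))
  (/-homo-+ (if p x then 1 else 0) (count p xs) n)
  where
  weight : ∀ b → (+ 1 / n) ℚ.* indicator b ≡ + (if b then 1 else 0) / n
  weight true  = ℚ.*-identityʳ (+ 1 / n)
  weight false = trans (ℚ.*-zeroʳ (+ 1 / n)) (sym (ℚ.0/n≡0 n))

sum-equalWeights : ∀ n .{{_ : NonZero n}} (xs : List A) →
                   sumℚ (map proj₁ (equalWeights n xs)) ≡ + length xs / n
sum-equalWeights n []       = sym (ℚ.0/n≡0 n)
sum-equalWeights n (x ∷ xs) = trans
  (cong (+ 1 / n ℚ.+_) (sum-equalWeights n xs)) (/-homo-+ 1 (length xs) n)

uniform : (xs : List A) .{{_ : NonZero (length xs)}} → Lottery A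
uniform xs = record
  { outcomes    = equalWeights (length xs) xs
  ; nonNegative = All.map⁺ (All.universal (λ _ → /-mono-≤ 0 1 1 (length xs) z≤n) xs)
  ; total       = trans (sum-equalWeights (length xs) xs) (n/n≡1 (length xs))
  }

-- Subsets of a given size

∣p∩q∣+∣p─q∣≡∣p∣ : ∀ (p q : Subset n) → ∣ p ∩ q ∣ + ∣ p ─ q ∣ ≡ ∣ p ∣
∣p∩q∣+∣p─q∣≡∣p∣ []            []            = refl
∣p∩q∣+∣p─q∣≡∣p∣ (inside  ∷ p) (inside  ∷ q) = cong suc (∣p∩q∣+∣p─q∣≡∣p∣ p q)
∣p∩q∣+∣p─q∣≡∣p∣ (inside  ∷ p) (outside ∷ q) = trans (ℕ.+-suc _ _) (cong suc (∣p∩q∣+∣p─q∣≡∣p∣ p q))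
∣p∩q∣+∣p─q∣≡∣p∣ (outside ∷ p) (inside  ∷ q) = ∣p∩q∣+∣p─q∣≡∣p∣ p q
∣p∩q∣+∣p─q∣≡∣p∣ (outside ∷ p) (outside ∷ q) = ∣p∩q∣+∣p─q∣≡∣p∣ p q

∣p─q∣≡∣p∣∸∣p∩q∣ : ∀ (p q : Subset n) → ∣ p ─ q ∣ ≡ ∣ p ∣ ∸ ∣ p ∩ q ∣
∣p─q∣≡∣p∣∸∣p∩q∣ p q = trans (sym (ℕ.m+n∸m≡n ∣ p ∩ q ∣ _)) (cong (_∸ ∣ p ∩ q ∣) (∣p∩q∣+∣p─q∣≡∣p∣ p q))

q⊆p⇒p∩q≡q : ∀ {p q : Subset n} → q ⊆ p → p ∩ q ≡ q
q⊆p⇒p∩q≡q {p = p} {q} q⊆p = ⊆-antisym (p∩q⊆q p q) λ x∈q → x∈p∩q⁺ (q⊆p x∈q , x∈q)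

q⊆p⇒∣p─q∣≡∣p∣∸∣q∣ : ∀ {p q : Subset n} → q ⊆ p → ∣ p ─ q ∣ ≡ ∣ p ∣ ∸ ∣ q ∣
q⊆p⇒∣p─q∣≡∣p∣∸∣q∣ {p = p} {q} q⊆p =
  trans (∣p─q∣≡∣p∣∸∣p∩q∣ p q) (cong (λ r → ∣ p ∣ ∸ ∣ r ∣) (q⊆p⇒p∩q≡q q⊆p))

x∈p─q⇒x∉q : ∀ {x : Fin n} (p q : Subset n) → x ∈ p ─ q → x ∉ q
x∈p─q⇒x∉q (_ ∷ p) (_ ∷ q) (there x∈) (there x∈q) = x∈p─q⇒x∉q p q x∈ x∈q

─-monoˡ-⊆ : ∀ {p q : Subset n} r → p ⊆ q → p ─ r ⊆ q ─ r
─-monoˡ-⊆ {p = p} r p⊆q x∈ = x∈p∧x∉q⇒x∈p─q (p⊆q (p─q⊆p p r x∈)) (x∈p─q⇒x∉q p r x∈)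

p─[q∩p]≡p─q : ∀ (p q : Subset n) → p ─ (q ∩ p) ≡ p ─ q
p─[q∩p]≡p─q []            []            = refl
p─[q∩p]≡p─q (inside  ∷ p) (inside  ∷ q) = cong (_ ∷_) (p─[q∩p]≡p─q p q)
p─[q∩p]≡p─q (inside  ∷ p) (outside ∷ q) = cong (_ ∷_) (p─[q∩p]≡p─q p q)
p─[q∩p]≡p─q (outside ∷ p) (inside  ∷ q) = cong (_ ∷_) (p─[q∩p]≡p─q p q)
p─[q∩p]≡p─q (outside ∷ p) (outside ∷ q) = cong (_ ∷_) (p─[q∩p]≡p─q p q)

∣p∣≡0⇒p≡⊥ : ∀ (p : Subset n) → ∣ p ∣ ≡ 0 → p ≡ ⊥
∣p∣≡0⇒p≡⊥ []            _    = refl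
∣p∣≡0⇒p≡⊥ (outside ∷ p) ∣p∣≡0 = cong (outside ∷_) (∣p∣≡0⇒p≡⊥ p ∣p∣≡0)

∣p∣≡1∧x∈p⇒p≡⁅x⁆ : ∀ {p : Subset n} {x} → ∣ p ∣ ≡ 1 → x ∈ p → p ≡ ⁅ x ⁆
∣p∣≡1∧x∈p⇒p≡⁅x⁆ {p = inside  ∷ p} ∣p∣≡1 here = cong (inside ∷_) (∣p∣≡0⇒p≡⊥ p (ℕ.suc-injective ∣p∣≡1))
∣p∣≡1∧x∈p⇒p≡⁅x⁆ {p = outside ∷ p} ∣p∣≡1 (there x∈p) = cong (outside ∷_) (∣p∣≡1∧x∈p⇒p≡⁅x⁆ ∣p∣≡1 x∈p)
∣p∣≡1∧x∈p⇒p≡⁅x⁆ {p = inside  ∷ p} ∣p∣≡1 (there x∈p) =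
  contradiction (subst (_ ∈_) (∣p∣≡0⇒p≡⊥ p (ℕ.suc-injective ∣p∣≡1)) x∈p) ∉⊥

∣⊥∩p∣≡0 : ∀ (p : Subset n) → ∣ ⊥ ∩ p ∣ ≡ 0
∣⊥∩p∣≡0 {n} p = trans (cong ∣_∣ (∩-zeroˡ p)) (∣⊥∣≡0 n)

elements : Subset n → List (Fin n)
elements []            = []
elements (inside  ∷ p) = zero ∷ map suc (elements p)
elements (outside ∷ p) = map suc (elements p)

length-elements : ∀ (p : Subset n) → length (elements p) ≡ ∣ p ∣
length-elements []            = refl
length-elements (inside  ∷ p) = cong suc (trans (List.length-map suc (elements p)) (length-elements p))
length-elements (outside ∷ p) = trans (List.length-map suc (elements p)) (length-elements p)

∈-elements : ∀ {p : Subset n} {x} → x ∈ p → x List.∈ elements p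
∈-elements {p = inside  ∷ p} here        = here refl
∈-elements {p = inside  ∷ p} (there x∈p) = there (List.∈-map⁺ suc (∈-elements x∈p))
∈-elements {p = outside ∷ p} (there x∈p) = List.∈-map⁺ suc (∈-elements x∈p)

-- The recursion follows Pascal's rule, so counts over this list reduce to the addition formula for
-- binomial coefficients.
choose : Subset n → ℕ → List (Subset n)
choose U             zero    = [ ⊥ ]
choose []            (suc k) = []
choose (inside  ∷ U) (suc k) = map (inside ∷_) (choose U k) ++ map (outside ∷_) (choose U (suc k))
choose (outside ∷ U) (suc k) = map (outside ∷_) (choose U (suc k))

choose-⊆ : ∀ (U : Subset n) k → All (λ A → A ⊆ U × ∣ A ∣ ≡ k) (choose U k)
choose-⊆ {n} U         zero    = (⊥⊆ , ∣⊥∣≡0 n) ∷ []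
choose-⊆ []            (suc k) = []
choose-⊆ (inside  ∷ U) (suc k) = All.++⁺
  (All.map⁺ {f = inside ∷_} (All.map (λ (A⊆U , ∣A∣) → (λ {x} → in⊆in A⊆U {x}) , cong suc ∣A∣) (choose-⊆ U k)))
  (All.map⁺ {f = outside ∷_} (All.map (λ (A⊆U , ∣A∣) → (λ {x} → out⊆ A⊆U {x}) , ∣A∣) (choose-⊆ U (suc k))))
choose-⊆ (outside ∷ U) (suc k) =
  All.map⁺ {f = outside ∷_} (All.map (λ (A⊆U , ∣A∣) → (λ {x} → out⊆ A⊆U {x}) , ∣A∣) (choose-⊆ U (suc k)))

choose-unique : ∀ (U : Subset n) k → Unique (choose U k)
choose-unique U             zero    = [] ∷ []
choose-unique []            (suc k) = []
choose-unique (inside  ∷ U) (suc k) = Unique.++⁺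
  (Unique.map⁺ (λ { refl → refl }) (choose-unique U k))
  (Unique.map⁺ (λ { refl → refl }) (choose-unique U (suc k)))
  λ (∈in , ∈out) → disjoint (List.∈-map⁻ _ ∈in) (List.∈-map⁻ _ ∈out)
  where
  disjoint : ∀ {A : Subset (suc _)} {xs ys} → (∃ λ B → B List.∈ xs × A ≡ inside ∷ B) →
             (∃ λ B → B List.∈ ys × A ≡ outside ∷ B) → _
  disjoint (_ , _ , refl) (_ , _ , ())
choose-unique (outside ∷ U) (suc k) = Unique.map⁺ (λ { refl → refl }) (choose-unique U (suc k))

length-choose : ∀ (U : Subset n) k → length (choose U k) ≡ ∣ U ∣ C k
length-choose U             zero    = refl
length-choose []            (suc k) = refl
length-choose (inside  ∷ U) (suc k) = begin
  length (choose (inside ∷ U) (suc k))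
    ≡⟨ List.length-++ (map (inside ∷_) (choose U k)) ⟩
  length (map (inside ∷_) (choose U k)) + length (map (outside ∷_) (choose U (suc k)))
    ≡⟨ cong₂ _+_ (List.length-map _ (choose U k)) (List.length-map _ (choose U (suc k))) ⟩
  length (choose U k) + length (choose U (suc k))
    ≡⟨ cong₂ _+_ (length-choose U k) (length-choose U (suc k)) ⟩
  ∣ U ∣ C k + ∣ U ∣ C suc k
    ≡⟨ nCk+nC[k+1]≡[n+1]C[k+1] ∣ U ∣ k ⟩
  suc ∣ U ∣ C suc k ∎
  where open ≡-Reasoning
length-choose (outside ∷ U) (suc k) = trans (List.length-map _ (choose U (suc k))) (length-choose U (suc k))

meets : ℕ → Subset n → Subset n → Bool
meets j T A = ∣ A ∩ T ∣ ≡ᵇ j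

count-choose-inside : ∀ (p : Subset (suc n) → Bool) U k →
  count p (choose (inside ∷ U) (suc k)) ≡
  count (p ∘ (inside ∷_)) (choose U k) + count (p ∘ (outside ∷_)) (choose U (suc k))
count-choose-inside p U k = trans
  (count-++ p (map (inside ∷_) (choose U k)) _)
  (cong₂ _+_ (count-map p (inside ∷_) (choose U k)) (count-map p (outside ∷_) (choose U (suc k))))

count-avoiding : ∀ (U T : Subset n) k → count (meets 0 T) (choose U k) ≡ ∣ U ─ T ∣ C k
count-avoiding U T zero rewrite ∣⊥∩p∣≡0 T = refl
count-avoiding [] [] (suc k) = refl
count-avoiding (inside ∷ U) (inside ∷ T) (suc k) = trans
  (count-choose-inside (meets 0 (inside ∷ T)) U k)
  -- A set containing the head meets `T` there, so the first summand vanishes.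
  (cong₂ _+_ (count-false (choose U k)) (count-avoiding U T (suc k)))
count-avoiding (inside ∷ U) (outside ∷ T) (suc k) = trans
  (count-choose-inside (meets 0 (outside ∷ T)) U k)
  (trans (cong₂ _+_ (count-avoiding U T k) (count-avoiding U T (suc k)))
         (nCk+nC[k+1]≡[n+1]C[k+1] ∣ U ─ T ∣ k))
count-avoiding (outside ∷ U) (inside  ∷ T) (suc k) =
  trans (count-map (meets 0 (inside ∷ T)) (outside ∷_) (choose U (suc k))) (count-avoiding U T (suc k))
count-avoiding (outside ∷ U) (outside ∷ T) (suc k) =
  trans (count-map (meets 0 (outside ∷ T)) (outside ∷_) (choose U (suc k))) (count-avoiding U T (suc k))

-- Such a set consists of one element of `U ∩ T` and `k` elements of `U ─ T`. In the induction, once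
-- the head is the common element, the rest must avoid `T`.
count-meetingOnce : ∀ (U T : Subset n) k →
  count (meets 1 T) (choose U (suc k)) ≡ ∣ U ∩ T ∣ * (∣ U ─ T ∣ C k)
count-meetingOnce [] [] k = refl
count-meetingOnce (inside ∷ U) (inside ∷ T) k = trans
  (count-choose-inside (meets 1 (inside ∷ T)) U k)
  (cong₂ _+_ (count-avoiding U T k) (count-meetingOnce U T k))
-- Size one is separate: taking the head leaves only the empty set, which adds nothing to the count,
-- while the induction hypothesis speaks of positive sizes.
count-meetingOnce (inside ∷ U) (outside ∷ T) zero = trans
  (count-choose-inside (meets 1 (outside ∷ T)) U zero)
  (trans (cong (λ m → (if m ≡ᵇ 1 then 1 else 0) + 0 + count (meets 1 T) (choose U 1)) (∣⊥∩p∣≡0 T))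
         (count-meetingOnce U T zero))
count-meetingOnce (inside ∷ U) (outside ∷ T) (suc k) = begin
  count (meets 1 (outside ∷ T)) (choose (inside ∷ U) (suc (suc k)))
    ≡⟨ count-choose-inside (meets 1 (outside ∷ T)) U (suc k) ⟩
  count (meets 1 T) (choose U (suc k)) + count (meets 1 T) (choose U (suc (suc k)))
    ≡⟨ cong₂ _+_ (count-meetingOnce U T k) (count-meetingOnce U T (suc k)) ⟩
  t * (s C k) + t * (s C suc k)
    ≡⟨ ℕ.*-distribˡ-+ t (s C k) (s C suc k) ⟨
  t * (s C k + s C suc k)
    ≡⟨ cong (t *_) (nCk+nC[k+1]≡[n+1]C[k+1] s k) ⟩
  t * (suc s C suc k) ∎
  where
  open ≡-Reasoning
  t = ∣ U ∩ T ∣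
  s = ∣ U ─ T ∣
count-meetingOnce (outside ∷ U) (inside  ∷ T) k =
  trans (count-map (meets 1 (inside ∷ T)) (outside ∷_) (choose U (suc k))) (count-meetingOnce U T k)
count-meetingOnce (outside ∷ U) (outside ∷ T) k =
  trans (count-map (meets 1 (outside ∷ T)) (outside ∷_) (choose U (suc k))) (count-meetingOnce U T k)

-- Binomial coefficients

≡ᵇ-true⇒≡ : ∀ {m n} → (m ≡ᵇ n) ≡ true → m ≡ n
≡ᵇ-true⇒≡ {m} {n} eq = ℕ.≡ᵇ⇒≡ m n (subst T (sym eq) _)

m+n≤o⇒n≤o∸m : ∀ m {n o} → m + n ≤ o → n ≤ o ∸ m
m+n≤o⇒n≤o∸m m {n} m+n≤o = subst (_≤ _) (ℕ.m+n∸m≡n m n) (ℕ.∸-monoˡ-≤ m m+n≤o)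

-- Multiplied out, so that factorial identities can be chained by multiplication alone.
C-factorial : ∀ a b → ((a + b) C a) * (a ! * b !) ≡ (a + b) !
C-factorial a b = begin
  ((a + b) C a) * (a ! * b !)                 ≡⟨ cong (λ m → ((a + b) C a) * (a ! * m !)) (ℕ.m+n∸m≡n a b) ⟨
  ((a + b) C a) * (a ! * (a + b ∸ a) !)       ≡⟨ cong (_* (a ! * (a + b ∸ a) !)) (nCk≡n!/k![n-k]! a≤a+b) ⟩
  _                                           ≡⟨ m/n*n≡m (k![n∸k]!∣n! a≤a+b) ⟩
  (a + b) !                                   ∎
  where
  open ≡-Reasoning
  a≤a+b = ℕ.m≤m+n a b
  instance _ = a ℕ.!* (a + b ∸ a) !≢0

-- Choosing `a`, then `b`, leaving `c` gives a multinomial coefficient, whose symmetry later permits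
-- choosing in another order.
multinomial : ∀ a b c →
  ((a + (b + c)) C a) * ((b + c) C b) * (a ! * (b ! * c !)) ≡ (a + (b + c)) !
multinomial a b c = begin
  x * y * (a ! * (b ! * c !))
    ≡⟨ solve 4 (λ x y p q → x :* y :* (p :* q) := x :* (p :* (y :* q))) refl x y (a !) (b ! * c !) ⟩
  x * (a ! * (y * (b ! * c !)))
    ≡⟨ cong (λ m → x * (a ! * m)) (C-factorial b c) ⟩
  x * (a ! * (b + c) !)
    ≡⟨ C-factorial a (b + c) ⟩
  (a + (b + c)) ! ∎
  where
  open ≡-Reasoning
  open +-*-Solver
  x = (a + (b + c)) C a
  y = (b + c) C b

-- After multiplication by k! r! s!, both sides are u!.
C-exchange : ∀ k r s → let u = suc k + (r + s) in
  suc k * (u C suc k) * ((r + s) C r) ≡ suc r * (u C suc r) * ((u ∸ suc r) C k)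
C-exchange k r s = ℕ.*-cancelʳ-≡ _ _ (k ! * (r ! * s !)) (begin
  suc k * x * y * (k ! * (r ! * s !))
    -- `suc k * k !` is `suc k !` by definition, so the stray factor completes a factorial.
    ≡⟨ solve 6 (λ m x y p q t → m :* x :* y :* (p :* (q :* t)) := x :* y :* (m :* p :* (q :* t)))
         refl (suc k) x y (k !) (r !) (s !) ⟩
  x * y * (suc k ! * (r ! * s !))
    ≡⟨ multinomial (suc k) r s ⟩
  u !
    ≡⟨ cong _! u≡ ⟩
  (suc r + (k + s)) !
    ≡⟨ multinomial (suc r) k s ⟨
  ((suc r + (k + s)) C suc r) * ((k + s) C k) * (suc r ! * (k ! * s !))
    ≡⟨ cong₂ (λ a b → (a C suc r) * (b C k) * (suc r ! * (k ! * s !)))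
         (sym u≡) (sym (trans (cong (_∸ suc r) u≡) (ℕ.m+n∸m≡n (suc r) (k + s)))) ⟩
  x′ * y′ * (suc r ! * (k ! * s !))
    ≡⟨ solve 6 (λ m x y p q t → x :* y :* (m :* q :* (p :* t)) := m :* x :* y :* (p :* (q :* t)))
         refl (suc r) x′ y′ (k !) (r !) (s !) ⟩
  suc r * x′ * y′ * (k ! * (r ! * s !)) ∎)
  where
  open ≡-Reasoning
  open +-*-Solver
  u = suc k + (r + s)
  x = u C suc k
  y = (r + s) C r
  x′ = u C suc r
  y′ = (u ∸ suc r) C k
  u≡ : u ≡ suc r + (k + s)
  u≡ = cong suc (solve 3 (λ k r s → k :+ (r :+ s) := r :+ (k :+ s)) refl k r s)
  instance _ = ℕ.m*n≢0 (k !) (r ! * s !) {{k ℕ.!≢0}} {{r ℕ.!* s !≢0}}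

-- The searcher's strategy

plans : ℕ → (r : ℕ) → Subset n → List (Vec (Subset n) r)
plans k zero    U = [ [] ]
plans k (suc r) U = concatMap (λ A → map (A ∷_) (plans k r (U ─ A))) (choose U k)

-- On disjoint sets this tests whether `T` is a transversal. Removing all of `A` from `T` keeps step
-- with `U ─ A` in `plans`.
splits : ∀ {r} → Subset n → Vec (Subset n) r → Bool
splits T []       = ∣ T ∣ ≡ᵇ 0
splits T (A ∷ As) = meets 1 T A ∧ splits (T ─ A) As

-- For `r * k ≤ u` this is the multinomial coefficient `u ! / (k ! ^ r * (u ∸ r * k) !)`.
planCount : ℕ → ℕ → ℕ → ℕ
planCount k zero    u = 1
planCount k (suc r) u = (u C k) * planCount k r (u ∸ k)

-- Here the sets of a plan have suc k elements, and the set to be split has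
-- as many elements as the plan has rounds.
splitCount : ℕ → ℕ → ℕ → ℕ
splitCount k zero    u = 1
splitCount k (suc r) u = suc r * ((u ∸ suc r) C k) * splitCount k r (u ∸ suc k)

length-plans : ∀ k r (U : Subset n) → length (plans k r U) ≡ planCount k r ∣ U ∣
length-plans k zero    U = refl
length-plans k (suc r) U = trans
  (length-concatMap _ (All.map rest (choose-⊆ U k)))
  (cong (_* planCount k r (∣ U ∣ ∸ k)) (length-choose U k))
  where
  rest : ∀ {A} → A ⊆ U × ∣ A ∣ ≡ k → length (map (A ∷_) (plans k r (U ─ A))) ≡ planCount k r (∣ U ∣ ∸ k)
  rest {A} (A⊆U , ∣A∣≡k) = begin
    length (map (A ∷_) (plans k r (U ─ A))) ≡⟨ List.length-map _ (plans k r (U ─ A)) ⟩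
    length (plans k r (U ─ A))              ≡⟨ length-plans k r (U ─ A) ⟩
    planCount k r ∣ U ─ A ∣                 ≡⟨ cong (planCount k r) (q⊆p⇒∣p─q∣≡∣p∣∸∣q∣ A⊆U) ⟩
    planCount k r (∣ U ∣ ∸ ∣ A ∣)           ≡⟨ cong (λ m → planCount k r (∣ U ∣ ∸ m)) ∣A∣≡k ⟩
    planCount k r (∣ U ∣ ∸ k)               ∎
    where open ≡-Reasoning

plans-legal : ∀ k r (U : Subset n) → All (Vec.All (λ A → ∣ A ∣ ≤ k)) (plans k r U)
plans-legal k zero    U = [] ∷ []
plans-legal k (suc r) U = All.concat⁺ (All.map⁺ (All.map
  (λ {A} (_ , ∣A∣≡k) → All.map⁺ (All.map (ℕ.≤-reflexive ∣A∣≡k ∷_) (plans-legal k r (U ─ A))))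
  (choose-⊆ U k)))

-- The first set must meet `T` once, which `count-meetingOnce` counts; the remaining sets face
-- `T ─ A`, one element smaller, inside `U ─ A`. Only sizes enter, so all placements are split
-- equally often.
count-splits : ∀ k r (U T : Subset n) → T ⊆ U → ∣ T ∣ ≡ r →
               count (splits T) (plans (suc k) r U) ≡ splitCount k r ∣ U ∣
count-splits k zero    U T T⊆U ∣T∣≡0 rewrite ∣T∣≡0 = refl
count-splits k (suc r) U T T⊆U ∣T∣≡1+r = trans
  (count-concatMap (splits T) (meets 1 T) _ (All.map rest (choose-⊆ U (suc k))))
  (cong (_* splitCount k r (∣ U ∣ ∸ suc k)) (begin
    count (meets 1 T) (choose U (suc k)) ≡⟨ count-meetingOnce U T k ⟩
    ∣ U ∩ T ∣ * (∣ U ─ T ∣ C k)          ≡⟨ cong₂ (λ a b → a * (b C k))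
                                              (trans (cong ∣_∣ (q⊆p⇒p∩q≡q T⊆U)) ∣T∣≡1+r)
                                              (trans (q⊆p⇒∣p─q∣≡∣p∣∸∣q∣ T⊆U) (cong (∣ U ∣ ∸_) ∣T∣≡1+r)) ⟩
    suc r * ((∣ U ∣ ∸ suc r) C k)        ∎))
  where
  open ≡-Reasoning
  rest : ∀ {A} → A ⊆ U × ∣ A ∣ ≡ suc k →
         count (splits T) (map (A ∷_) (plans (suc k) r (U ─ A))) ≡
         (if meets 1 T A then splitCount k r (∣ U ∣ ∸ suc k) else 0)
  rest {A} (A⊆U , ∣A∣≡1+k) = trans (count-map (splits T) (A ∷_) (plans (suc k) r (U ─ A)))
    (trans (count-∧ (meets 1 T A) (splits (T ─ A)) (plans (suc k) r (U ─ A))) (inner (meets 1 T A) refl))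
    where
    -- Passing the Boolean with its equation lets the true branch recover that `A` and `T` share
    -- exactly one element.
    inner : ∀ b → meets 1 T A ≡ b →
            (if b then count (splits (T ─ A)) (plans (suc k) r (U ─ A)) else 0) ≡
            (if b then splitCount k r (∣ U ∣ ∸ suc k) else 0)
    inner false _  = refl
    inner true  eq = begin
      count (splits (T ─ A)) (plans (suc k) r (U ─ A)) ≡⟨ count-splits k r (U ─ A) (T ─ A) (─-monoˡ-⊆ A T⊆U) ∣T─A∣≡r ⟩
      splitCount k r ∣ U ─ A ∣         ≡⟨ cong (splitCount k r) (q⊆p⇒∣p─q∣≡∣p∣∸∣q∣ A⊆U) ⟩
      splitCount k r (∣ U ∣ ∸ ∣ A ∣)   ≡⟨ cong (λ m → splitCount k r (∣ U ∣ ∸ m)) ∣A∣≡1+k ⟩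
      splitCount k r (∣ U ∣ ∸ suc k)   ∎
      where
      ∣T─A∣≡r : ∣ T ─ A ∣ ≡ r
      ∣T─A∣≡r = trans (∣p─q∣≡∣p∣∸∣p∩q∣ T A)
        (cong₂ _∸_ ∣T∣≡1+r (trans (cong ∣_∣ (∩-comm T A)) (≡ᵇ-true⇒≡ eq)))

planCount-nonZero : ∀ k r u → r * k ≤ u → NonZero (planCount k r u)
planCount-nonZero k zero    u _     = _
planCount-nonZero k (suc r) u rk≤u = ℕ.m*n≢0 (u C k) _
  {{C-nonZero (ℕ.≤-trans (ℕ.m≤m+n k (r * k)) rk≤u)}}
  {{planCount-nonZero k r (u ∸ k) (m+n≤o⇒n≤o∸m k rk≤u)}}

-- Both sides count pairs of a plan and an `r`-set split by it: a plan has `suc k ^ r` transversals,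
-- and an `r`-set is split by `splitCount k r u` plans. The proof is an algebraic induction.
planCount*k^r : ∀ k r u → r * suc k ≤ u → planCount (suc k) r u * suc k ^ r ≡ (u C r) * splitCount k r u
planCount*k^r k zero    u _     = refl
planCount*k^r k (suc r) u rk≤u = begin
  (u C suc k) * planCount (suc k) r v * (suc k * suc k ^ r)
    ≡⟨ solve 4 (λ x p m q → x :* p :* (m :* q) := m :* x :* (p :* q)) refl
         (u C suc k) (planCount (suc k) r v) (suc k) (suc k ^ r) ⟩
  suc k * (u C suc k) * (planCount (suc k) r v * suc k ^ r)
    ≡⟨ cong (suc k * (u C suc k) *_) (planCount*k^r k r v rk≤v) ⟩
  suc k * (u C suc k) * ((v C r) * S)
    ≡⟨ ℕ.*-assoc (suc k * (u C suc k)) (v C r) S ⟨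
  suc k * (u C suc k) * (v C r) * S
    -- Both sides count `suc k` elements, one of them marked, with `r` elements outside. Moving the
    -- marked element to the other group gives `suc r` elements, one marked, with `k` outside.
    ≡⟨ cong (_* S) exchange ⟩
  suc r * (u C suc r) * ((u ∸ suc r) C k) * S
    ≡⟨ solve 4 (λ m x y s → m :* x :* y :* s := x :* (m :* y :* s)) refl
         (suc r) (u C suc r) ((u ∸ suc r) C k) S ⟩
  (u C suc r) * (suc r * ((u ∸ suc r) C k) * S) ∎
  where
  open ≡-Reasoning
  open +-*-Solver
  v = u ∸ suc k
  S = splitCount k r v
  rk≤v : r * suc k ≤ v
  rk≤v = m+n≤o⇒n≤o∸m (suc k) rk≤u
  r+[v∸r]≡v : r + (v ∸ r) ≡ v
  r+[v∸r]≡v = ℕ.m+[n∸m]≡n (ℕ.≤-trans (ℕ.m≤m*n r (suc k)) rk≤v)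
  exchange : suc k * (u C suc k) * (v C r) ≡ suc r * (u C suc r) * ((u ∸ suc r) C k)
  -- `C-exchange` is stated with sums; `s = v ∸ r` together with `r ≤ v` restores `u` and `v`.
  exchange = subst₂
    (λ u v → suc k * (u C suc k) * (v C r) ≡ suc r * (u C suc r) * ((u ∸ suc r) C k))
    (trans (cong (λ m → suc k + m) r+[v∸r]≡v) (ℕ.m+[n∸m]≡n (ℕ.≤-trans (ℕ.m≤m+n (suc k) (r * suc k)) rk≤u)))
    r+[v∸r]≡v
    (C-exchange k r (v ∸ r))

-- A strategy must answer every history; the default `⊥` respects the size bound and is not reached
-- in the first `r` rounds.
at : ∀ {r} → Vec (Subset n) r → ℕ → Subset n
at []       _       = ⊥
at (A ∷ As) zero    = A
at (A ∷ As) (suc i) = at As i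

∣at∣≤k : ∀ {r k} {As : Vec (Subset n) r} → Vec.All (λ A → ∣ A ∣ ≤ k) As → ∀ i → ∣ at As i ∣ ≤ k
∣at∣≤k {n} []           _       = subst (_≤ _) (sym (∣⊥∣≡0 n)) z≤n
∣at∣≤k (∣A∣≤k ∷ _)      zero    = ∣A∣≤k
∣at∣≤k (_ ∷ ∣As∣≤k)     (suc i) = ∣at∣≤k ∣As∣≤k i

followPlan : ∀ {r k} {As : Vec (Subset n) r} → Vec.All (λ A → ∣ A ∣ ≤ k) As → SearcherStrategy n k
followPlan {As = As} legal = record
  { guess   = at As ∘ length
  ; guess≤k = ∣at∣≤k legal ∘ length
  }

module _ {k d r : ℕ} {As : Vec (Subset n) r}
         (legal : Vec.All (λ A → ∣ A ∣ ≤ k) As) (τ : HiderStrategy n d) where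
  open HiderStrategy τ

  unfound-∷ : ∀ q a h → unfound ((q , a) ∷ h) ≡ unfound h ─ ⁅ a ⁆
  unfound-∷ q a h = trans
    (cong (treasures ─_) (∪-comm ⁅ a ⁆ (found h)))
    (sym (p─q─r≡p─q∪r treasures (found h) ⁅ a ⁆))

  -- Induction on the unplayed sets `Bs`, which the equation on `at` ties to the current round. The
  -- next set holds one unfound treasure, so under any reveal rule the unfound set evolves as in
  -- `splits`.
  splits⇒winsFrom : ∀ {r′} (Bs : Vec (Subset n) r′) h → (∀ i → at As (i + length h) ≡ at Bs i) →
                    splits (unfound h) Bs ≡ true → searcherWinsFrom (followPlan legal) τ r′ h ≡ true
  splits⇒winsFrom []       h _    ok = dec-true (treasures ⊆? found h) λ {x} x∈T → ⊆found x∈T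
    where
    ⊆found : treasures ⊆ found h
    ⊆found {x} x∈T with x ∈? found h
    ... | yes x∈found = x∈found
    ... | no  x∉found = contradiction
      (subst (x ∈_) (∣p∣≡0⇒p≡⊥ (unfound h) (≡ᵇ-true⇒≡ ok)) (x∈p∧x∉q⇒x∈p─q x∈T x∉found)) ∉⊥
  splits⇒winsFrom (A ∷ Bs) h As≗Bs ok
    -- `As≗Bs 0` identifies the guess of this round with `A`.
    rewrite As≗Bs 0 with nonempty? (A ∩ unfound h)
  ... | no  empty = contradiction
    (trans (sym ∣A∩X∣≡1) (trans (cong ∣_∣ (Empty-unique empty)) (∣⊥∣≡0 n))) λ ()
    where
    ∣A∩X∣≡1 : ∣ A ∩ unfound h ∣ ≡ 1
    ∣A∩X∣≡1 = ≡ᵇ-true⇒≡ (Bool.∧-conicalˡ _ _ ok)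
  ... | yes nonempty = splits⇒winsFrom Bs ((A , a) ∷ h)
    (λ i → trans (cong (at As) (ℕ.+-suc i (length h))) (As≗Bs (suc i)))
    (trans (cong (λ X → splits X Bs) X─⁅a⁆≡X─A) (Bool.∧-conicalʳ _ _ ok))
    where
    X = unfound h
    a = reveal h A
    ∣A∩X∣≡1 : ∣ A ∩ X ∣ ≡ 1
    ∣A∩X∣≡1 = ≡ᵇ-true⇒≡ (Bool.∧-conicalˡ _ _ ok)
    X─⁅a⁆≡X─A : unfound ((A , a) ∷ h) ≡ X ─ A
    X─⁅a⁆≡X─A = begin
      unfound ((A , a) ∷ h) ≡⟨ unfound-∷ A a h ⟩
      -- The legal answer is the only element of `A ∩ X`, so deleting it removes all of `A` from
      -- `X`.
      X ─ ⁅ a ⁆             ≡⟨ cong (X ─_) (∣p∣≡1∧x∈p⇒p≡⁅x⁆ ∣A∩X∣≡1 (reveal-legal h A nonempty)) ⟨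
      X ─ (A ∩ X)           ≡⟨ p─[q∩p]≡p─q X A ⟩
      X ─ A                 ∎
      where open ≡-Reasoning

splits⇒wins : ∀ {d k} {As : Vec (Subset n) d} (legal : Vec.All (λ A → ∣ A ∣ ≤ k) As)
              (τ : HiderStrategy n d) → splits (HiderStrategy.treasures τ) As ≡ true →
              searcherWins (followPlan legal) τ ≡ true
splits⇒wins {As = As} legal τ ok = splits⇒winsFrom legal τ As []
  (λ i → cong (at As) (ℕ.+-identityʳ i))
  (trans (cong (λ X → splits X As) (p─⊥≡p (HiderStrategy.treasures τ))) ok)

searcherStrategies : ∀ n d k → List (SearcherStrategy n k)
searcherStrategies n d k = All.reduce followPlan (plans-legal k d (⊤ {n}))

length-searcherStrategies : ∀ n d k → length (searcherStrategies n d k) ≡ planCount k d n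
length-searcherStrategies n d k = begin
  length (searcherStrategies n d k) ≡⟨ length-reduce followPlan (plans-legal k d (⊤ {n})) ⟩
  length (plans k d (⊤ {n}))        ≡⟨ length-plans k d (⊤ {n}) ⟩
  planCount k d ∣ ⊤ {n} ∣           ≡⟨ cong (planCount k d) (∣⊤∣≡n n) ⟩
  planCount k d n                   ∎
  where open ≡-Reasoning

splitCount≤wins : ∀ {n d k} (τ : HiderStrategy n d) →
  splitCount k d n ≤ count (λ σ → searcherWins σ τ) (searcherStrategies n d (suc k))
splitCount≤wins {n} {d} {k} τ = ℕ.≤-trans
  (ℕ.≤-reflexive (sym (trans (count-splits k d ⊤ treasures ⊆⊤ ∣treasures∣) (cong (splitCount k d) (∣⊤∣≡n n)))))
  (count-reduce (splits treasures) (λ σ → searcherWins σ τ) followPlan (plans-legal (suc k) d ⊤)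
    λ legal → splits⇒wins legal τ)
  where open HiderStrategy τ

-- The hider's strategy

-- `door` makes `reveal` total: it answers a guess without unfound treasure, when the searcher has
-- already lost.
hide : Fin n → ∀ {d} (T : Subset n) → ∣ T ∣ ≡ d → HiderStrategy n d
hide {n} door T ∣T∣≡d = record
  { treasures    = T
  ; ∣treasures∣  = ∣T∣≡d
  ; reveal       = reveal
  ; reveal-legal = legal
  }
  where
  reveal : History n → Subset n → Fin n
  reveal h q with nonempty? (q ∩ (T ─ found h))
  ... | yes (a , _) = a
  ... | no  _       = door
  legal : ∀ h q → Nonempty (q ∩ (T ─ found h)) → reveal h q ∈ q ∩ (T ─ found h)
  legal h q nonempty with nonempty? (q ∩ (T ─ found h))
  ... | yes (_ , a∈) = a∈
  ... | no  empty    = contradiction nonempty empty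

hiderStrategies : ∀ n → Fin n → ∀ d → List (HiderStrategy n d)
hiderStrategies n door d = All.reduce (λ {T} (_ , ∣T∣≡d) → hide door T ∣T∣≡d) (choose-⊆ ⊤ d)

length-hiderStrategies : ∀ n door d → length (hiderStrategies n door d) ≡ n C d
length-hiderStrategies n door d = begin
  length (hiderStrategies n door d) ≡⟨ length-reduce _ (choose-⊆ (⊤ {n}) d) ⟩
  length (choose (⊤ {n}) d)        ≡⟨ length-choose (⊤ {n}) d ⟩
  ∣ ⊤ {n} ∣ C d                    ≡⟨ cong (_C d) (∣⊤∣≡n n) ⟩
  n C d                            ∎
  where open ≡-Reasoning

module _ {n k : ℕ} (σ : SearcherStrategy n k) where
  open SearcherStrategy σ

  -- The final found sets over all answer sequences inside the guesses. No hider strategy enters, so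
  -- one list serves every placement.
  reachable : ℕ → History n → List (Subset n)
  reachable zero    h = [ found h ]
  reachable (suc r) h = concatMap (λ a → reachable r ((guess h , a) ∷ h)) (elements (guess h))

  length-reachable : ∀ r h → length (reachable r h) ≤ k ^ r
  length-reachable zero    h = ℕ.≤-refl
  length-reachable (suc r) h = begin
    length (reachable (suc r) h)
      ≤⟨ length-concatMap-≤ _ (elements (guess h)) (λ a → length-reachable r ((guess h , a) ∷ h)) ⟩
    length (elements (guess h)) * k ^ r  ≡⟨ cong (_* k ^ r) (length-elements (guess h)) ⟩
    ∣ guess h ∣ * k ^ r                  ≤⟨ ℕ.*-monoˡ-≤ (k ^ r) (guess≤k h) ⟩
    k * k ^ r                            ∎
    where open ℕ.≤-Reasoning

  -- A won play ends with `treasures ⊆ found h`. The invariant `found h ⊆ treasures` makes this an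
  -- equality, so the answers determine the placement.
  winsFrom⇒reachable : ∀ {d} (τ : HiderStrategy n d) r h → found h ⊆ HiderStrategy.treasures τ →
    searcherWinsFrom σ τ r h ≡ true → HiderStrategy.treasures τ List.∈ reachable r h
  winsFrom⇒reachable τ zero h found⊆T wins with HiderStrategy.treasures τ ⊆? found h
  ... | yes T⊆found = here (⊆-antisym T⊆found found⊆T)
  winsFrom⇒reachable τ (suc r) h found⊆T wins with nonempty? (guess h ∩ HiderStrategy.unfound τ h)
  ... | yes nonempty = List.∈-concatMap⁺ _ (Any.map
      (λ { refl → winsFrom⇒reachable τ r ((guess h , a) ∷ h) found′⊆T wins })
      (∈-elements (proj₁ a∈)))
    where
    open HiderStrategy τ
    a = reveal h (guess h)
    a∈ : a ∈ guess h × a ∈ unfound h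
    a∈ = x∈p∩q⁻ (guess h) (unfound h) (reveal-legal h (guess h) nonempty)
    found′⊆T : ⁅ a ⁆ ∪ found h ⊆ treasures
    found′⊆T x∈ with x∈p∪q⁻ ⁅ a ⁆ (found h) x∈
    ... | inj₁ x∈⁅a⁆ rewrite x∈⁅y⁆⇒x≡y a x∈⁅a⁆ = p─q⊆p treasures (found h) (proj₂ a∈)
    ... | inj₂ x∈found = found⊆T x∈found

  -- Distinct entries of `hiderStrategies` have distinct treasure sets, and each one that loses has
  -- its set among the at most `k ^ d` reachable ones.
  wins≤k^d : ∀ door d → count (searcherWins σ) (hiderStrategies n door d) ≤ k ^ d
  wins≤k^d door d = ℕ.≤-trans
    (count-≤-length (searcherWins {d = d} σ) HiderStrategy.treasures
      (subst Unique (sym (map-reduce HiderStrategy.treasures _ (choose-⊆ ⊤ d) (λ _ → refl))) (choose-unique (⊤ {n}) d))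
      (λ {τ} _ → winsFrom⇒reachable τ d [] ⊥⊆))
    (length-reachable d [])

-- Optimality of the two uniform mixtures

theorem1 : (n d k : ℕ) .{{_ : NonZero n}} .{{_ : NonZero d}} .{{_ : NonZero k}} →
    (d*k≤n : d * k ≤ n) →
    IsValue (searchGame n d k) (_/_ (+ (k ^ d)) (n C d) {{d*k≤n⇒nCd≢0 d k d*k≤n}})
theorem1 n@(suc _) d k@(suc k′) d*k≤n = (μ , μ-secures) , (ν , ν-concedes)
  where
  open ZeroSumGame (searchGame n d k)

  σs = searcherStrategies n d k
  -- The default answer `zero` exists because `n` is positive.
  τs = hiderStrategies n zero d

  instance
    nCd≢0 : NonZero (n C d)
    nCd≢0 = d*k≤n⇒nCd≢0 d k d*k≤n

    ∣σs∣≢0 : NonZero (length σs)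
    ∣σs∣≢0 = subst NonZero (sym (length-searcherStrategies n d k)) (planCount-nonZero k d n d*k≤n)

    ∣τs∣≢0 : NonZero (length τs)
    ∣τs∣≢0 = subst NonZero (sym (length-hiderStrategies n zero d)) nCd≢0

  value = + (k ^ d) / (n C d)

  μ = uniform σs
  ν = uniform τs

  -- The bound on the winning fraction of plans, cleared of denominators; the only inequality in the
  -- chain is `splitCount≤wins`.
  k^d*∣σs∣≤ : ∀ τ → k ^ d * length σs ≤ count (λ σ → searcherWins σ τ) σs * (n C d)
  k^d*∣σs∣≤ τ = begin
    k ^ d * length σs                              ≡⟨ cong (k ^ d *_) (length-searcherStrategies n d k) ⟩
    k ^ d * planCount k d n                        ≡⟨ ℕ.*-comm (k ^ d) (planCount k d n) ⟩
    planCount k d n * k ^ d                        ≡⟨ planCount*k^r k′ d n d*k≤n ⟩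
    (n C d) * splitCount k′ d n                    ≡⟨ ℕ.*-comm (n C d) (splitCount k′ d n) ⟩
    splitCount k′ d n * (n C d)                    ≤⟨ ℕ.*-monoˡ-≤ (n C d) (splitCount≤wins τ) ⟩
    count (λ σ → searcherWins σ τ) σs * (n C d)    ∎
    where open ℕ.≤-Reasoning

  μ-secures : ∀ ν′ → value ℚ.≤ expectedPayoff μ ν′
  -- The average over plans is moved inside, so that each pure hider strategy is treated separately.
  μ-secures ν′ = subst (value ℚ.≤_)
    (sym (weightedSum-swap (outcomes μ) (outcomes ν′) payoff))
    (expectation-≥ ν′ λ τ → subst (value ℚ.≤_)
      (sym (weightedSum-indicator (length σs) (λ σ → searcherWins σ τ) σs))
      (/-mono-≤ (k ^ d) (count (λ σ → searcherWins σ τ) σs) (n C d) (length σs) (k^d*∣σs∣≤ τ)))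

  ν-concedes : ∀ μ′ → expectedPayoff μ′ ν ℚ.≤ value
  -- The average over placements is already the inner one, so each pure searcher strategy is bounded
  -- directly.
  ν-concedes μ′ = expectation-≤ μ′ λ σ → subst (ℚ._≤ value)
    (sym (weightedSum-indicator (length τs) (searcherWins σ) τs))
    (/-mono-≤ (count (searcherWins σ) τs) (k ^ d) (length τs) (n C d)
      (ℕ.*-mono-≤ (wins≤k^d σ zero d) (ℕ.≤-reflexive (sym (length-hiderStrategies n zero d)))))
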